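{- Let $n\ge 1$ and $0\le t<n$ be integers, and write $n=(n-t)q+r$ where $q,r$ are the unique integers with $0\le r<n-t$. Then \[ S(n,t,2)=q^{\,n-t-r}(q+1)^r. \]
   Context: A CNF formula over variables $x_1,\dots,x_n$ is a conjunction of clauses (disjunctions of literals); a $k$-CNF has all clauses of width at most $k$. $\mathrm{sat}_t(F)$ denotes the set of satisfying assignments of $F$ of Hamming weight exactly $t$. $F$ is $t$-admissible if it has no satisfying assignment of Hamming weight less than $t$. $S(n,t,k)$ is the maximum of $|\mathrm{sat}_t(F)|$ over all $t$-admissible $k$-CNF formulas $F$ on $n$ variables. -}

module Defs where

open import Data.Bool using (Bool; true; false)
import Data.Bool.Properties as Bool
open import Data.Fin using (Fin)
open import Data.Fin.Subset using (∣_∣)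
open import Data.List using (List; []; _∷_; _++_; map; filter; length)
open import Data.List.Membership.Propositional using (_∈_)
open import Data.List.Membership.Propositional.Properties
  using (∈-map⁺; ∈-map⁻; ∈-++⁺ˡ; ∈-++⁺ʳ)
open import Data.List.Relation.Unary.All using (All; all?; []; _∷_)
open import Data.List.Relation.Unary.Any using (Any; any?; here)
open import Data.List.Relation.Unary.Unique.Propositional using (Unique; []; _∷_)
import Data.List.Relation.Unary.Unique.Propositional.Properties as Unique
open import Data.Nat using (ℕ; zero; suc; _≤_; _<_; _≟_)
open import Data.Product using (Σ; ∃; _×_; _,_)
open import Data.Vec as Vec using (Vec; lookup)
open import Data.Vec.Properties using (∷-injectiveʳ)
open import Relation.Binary.PropositionalEquality using (_≡_; refl)
open import Relation.Nullary using (Dec; ¬_; _×-dec_)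

data Literal (n : ℕ) : Set where
  pos neg : Fin n → Literal n

Clause : ℕ → Set
Clause n = List (Literal n)

CNF : ℕ → Set
CNF n = List (Clause n)

width : ∀ {n} → Clause n → ℕ
width = length

_IsCNFOfWidth≤_ : ∀ {n} → CNF n → ℕ → Set
F IsCNFOfWidth≤ k = All (λ c → width c ≤ k) F

Assignment : ℕ → Set
Assignment n = Vec Bool n

-- An assignment is definitionally a Subset n (the set of true variables),
-- and its Hamming weight is the cardinality of that subset.
weight : ∀ {n} → Assignment n → ℕ
weight a = ∣ a ∣

LiteralTrue : ∀ {n} → Assignment n → Literal n → Set
LiteralTrue a (pos i) = lookup a i ≡ true
LiteralTrue a (neg i) = lookup a i ≡ false

_⊨_ : ∀ {n} → Assignment n → CNF n → Set
a ⊨ F = All (Any (LiteralTrue a)) F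

literalTrue? : ∀ {n} (a : Assignment n) (l : Literal n) → Dec (LiteralTrue a l)
literalTrue? a (pos i) = lookup a i Bool.≟ true
literalTrue? a (neg i) = lookup a i Bool.≟ false

_⊨?_ : ∀ {n} (a : Assignment n) (F : CNF n) → Dec (a ⊨ F)
a ⊨? F = all? (any? (literalTrue? a)) F

assignments : ∀ n → List (Assignment n)
assignments zero    = Vec.[] ∷ []
assignments (suc n) =
  map (false Vec.∷_) (assignments n) ++ map (true Vec.∷_) (assignments n)

∈-assignments : ∀ {n} (a : Assignment n) → a ∈ assignments n
∈-assignments Vec.[]            = here refl
∈-assignments (false Vec.∷ a) = ∈-++⁺ˡ (∈-map⁺ _ (∈-assignments a))
∈-assignments {suc n} (true Vec.∷ a) =
  ∈-++⁺ʳ (map (false Vec.∷_) (assignments n)) (∈-map⁺ _ (∈-assignments a))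

assignments-unique : ∀ n → Unique (assignments n)
assignments-unique zero    = [] ∷ []
assignments-unique (suc n) =
  Unique.++⁺ (Unique.map⁺ ∷-injectiveʳ (assignments-unique n))
             (Unique.map⁺ ∷-injectiveʳ (assignments-unique n))
             disjoint
  where
  disjoint : ∀ {a} → ¬ (a ∈ map (false Vec.∷_) (assignments n) ×
                        a ∈ map (true Vec.∷_) (assignments n))
  disjoint (p , q) with ∈-map⁻ _ p | ∈-map⁻ _ q
  ... | _ , _ , refl | _ , _ , ()

sat : ∀ {n} → ℕ → CNF n → List (Assignment n)
sat {n} t F = filter (λ a → (a ⊨? F) ×-dec (weight a ≟ t)) (assignments n)

-- Since the enumeration has no repetitions, the length is the cardinality.
#sat : ∀ {n} → ℕ → CNF n → ℕ
#sat t F = length (sat t F)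

Admissible : ∀ {n} → ℕ → CNF n → Set
Admissible {n} t F = ¬ (Σ (Assignment n) λ a → a ⊨ F × weight a < t)

IsMaximum : (ℕ → Set) → ℕ → Set
IsMaximum P m = P m × (∀ m′ → P m′ → m′ ≤ m)

-- S[ n , t , k ]≡ m says that S(n,t,k), the maximum of |sat_t(F)| over the
-- t-admissible k-CNFs F on n variables, equals m.
S[_,_,_]≡_ : ℕ → ℕ → ℕ → ℕ → Set
S[ n , t , k ]≡ m =
  IsMaximum (λ s → ∃ λ (F : CNF n) → F IsCNFOfWidth≤ k × Admissible t F × #sat t F ≡ s) m

{-# OPTIONS --safe #-}

-- Record an assignment by its set of zeros; with d = n ∸ t, admissibility says that
-- no solution has more than d zeros, and the solutions with exactly d zeros are to
-- be counted.  Solutions of a 2-CNF are closed under the coordinatewise majority.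
--
-- Upper bound, by induction on d, for a majority-closed family: choose an element v
-- lying in the largest number c of maximum sets, let V′ consist of the elements
-- other than v sharing a maximum set with v, and let W be the complement of V′.
-- A maximum set A ⊆ V′ could be enlarged by v: take majorities of A with sets
-- containing v and one more element of A.  So every maximum set meets W and there
-- are at most ∣W∣ · c of them; the c sets through v are again maximum sets of a
-- majority-closed family, now on V′ and of size d ∸ 1.  Hence the count is at most a
-- product of d numbers of sum at most n, which is largest when these are as equal as possible.
--
-- For the lower bound, cut the variables into d blocks and forbid two zeros in a block.
module Submission where

open import Defs
open import Data.Bool using (Bool; true; false)
import Data.Bool.Properties as Bool
open import Data.Empty using (⊥)
open import Data.Fin using (Fin; zero; suc; _↑ˡ_; _↑ʳ_)
import Data.Fin.Properties as Fin
open import Data.List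
  using (List; []; _∷_; _++_; map; filter; length; lookup; allFin; tabulate; replicate;
         cartesianProductWith)
open import Data.List.Extrema.Nat using (argmax; argmax-sel; f[xs]≤f[argmax])
open import Data.List.Membership.Propositional using (_∈_; find; lose)
open import Data.List.Membership.Propositional.Properties
  using (∈-filter⁺; ∈-filter⁻; ∈-allFin; ∈-lookup; ∈-cartesianProductWith⁻; ∈-length)
import Data.List.Properties as List
open import Data.List.Relation.Binary.Permutation.Propositional
  using (_↭_; ↭-refl; ↭-sym; ↭-trans; prep)
open import Data.List.Relation.Binary.Permutation.Propositional.Properties
  using (shift; filter-↭; ↭-length)
open import Data.List.Relation.Unary.All as All using (All; []; _∷_)
import Data.List.Relation.Unary.All.Properties as All
open import Data.List.Relation.Unary.AllPairs using ([]; _∷_)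
open import Data.List.Relation.Unary.Any as Any using (Any; any?; here; there; index)
import Data.List.Relation.Unary.Any.Properties as Any
open import Data.List.Relation.Unary.Unique.Propositional using (Unique)
import Data.List.Relation.Unary.Unique.Propositional.Properties as Unique
open import Data.Nat
  using (ℕ; zero; suc; _+_; _*_; _∸_; _^_; _≤_; _<_; _≟_; z≤n; s≤s; NonZero)
open import Data.Nat.ListAction using (sum; product)
open import Data.Nat.ListAction.Properties using (sum-++; product-++)
open import Data.Nat.Properties
  using (≤-refl; ≤-reflexive; ≤-trans; ≤-antisym; ≤-total; ≮⇒≥; <⇒≤; <⇒≱; m≤n+m; n≤1+n; m∸n≤m;
         m∸n+n≡m; m+n∸n≡m; m+[n∸m]≡n; +-comm; +-suc; +-mono-≤; +-monoʳ-≤; +-monoˡ-≤;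
         +-cancelˡ-≤; +-cancelʳ-≤; +-cancelˡ-≡; +-cancelʳ-≡; *-assoc; *-comm; *-suc; *-zeroʳ;
         *-mono-≤; *-monoˡ-≤; *-monoʳ-≤; *-cancelˡ-≤; *-cancelʳ-≤; m*n≢0; m^n≢0; ^-monoˡ-≤;
         ^-distribˡ-+-*; ^-*-assoc; module ≤-Reasoning)
open import Data.Nat.Solver using (module +-*-Solver)
open import Data.Product using (∃; _×_; _,_; proj₁; proj₂)
open import Data.Sum using (inj₁; inj₂)
open import Data.Vec as Vec using (Vec)
import Data.Vec.Properties as Vec
open import Function using (_∘_; id; Injective)
open import Relation.Binary.Definitions using (Decidable; DecidableEquality)
open import Relation.Binary.PropositionalEquality
  using (_≡_; _≢_; refl; sym; trans; cong; cong₂; subst; _≗_)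
open import Relation.Nullary using (¬_; yes; no; ¬?; _×-dec_; contradiction; decidable-stable)
import Relation.Unary as U

-- Lists

module _ {A : Set} where

  ↭-filter-++ : {P : A → Set} (P? : U.Decidable P) (xs : List A) →
                xs ↭ filter P? xs ++ filter (¬? ∘ P?) xs
  ↭-filter-++ P? [] = ↭-refl
  ↭-filter-++ P? (x ∷ xs) with P? x
  ... | yes _ = prep x (↭-filter-++ P? xs)
  ... | no _  = ↭-trans (prep x (↭-filter-++ P? xs)) (↭-sym (shift x (filter P? xs) _))

  -- Applied to a list of elements, this splits a set between `V′` and `W`; applied to a list of
  -- sets, it splits the sets through one element by whether they contain another.
  length-filter-split :
    {P Q : A → Set} (P? : U.Decidable P) (Q? : U.Decidable Q) (xs : List A) →
    length (filter Q? xs) ≡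
      length (filter Q? (filter P? xs)) + length (filter Q? (filter (¬? ∘ P?) xs))
  length-filter-split P? Q? xs = begin-equality
    length (filter Q? xs)                  ≡⟨ ↭-length (filter-↭ Q? (↭-filter-++ P? xs)) ⟩
    length (filter Q? (ys ++ zs))          ≡⟨ cong length (List.filter-++ Q? ys zs) ⟩
    length (filter Q? ys ++ filter Q? zs)  ≡⟨ List.length-++ (filter Q? ys) ⟩
    length (filter Q? ys) + length (filter Q? zs) ∎
    where
    open ≤-Reasoning
    ys = filter P? xs
    zs = filter (¬? ∘ P?) xs

  lookup-injective : {xs : List A} → Unique xs → Injective _≡_ _≡_ (lookup xs)
  lookup-injective (x∉xs ∷ xs!) {zero}  {zero}  _  = refl
  lookup-injective (x∉xs ∷ xs!) {zero}  {suc j} eq =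
    contradiction eq (All.lookup x∉xs (∈-lookup j))
  lookup-injective (x∉xs ∷ xs!) {suc i} {zero}  eq =
    contradiction (sym eq) (All.lookup x∉xs (∈-lookup i))
  lookup-injective (x∉xs ∷ xs!) {suc i} {suc j} eq = cong suc (lookup-injective xs! eq)

  -- Pigeonhole: sending each position of `xs` to a position of `ys` with the same entry is
  -- injective, because `xs` has no repetitions.
  length-mono-⊆ : {xs ys : List A} → Unique xs → (∀ {x} → x ∈ xs → x ∈ ys) →
                  length xs ≤ length ys
  length-mono-⊆ {xs} {ys} xs! xs⊆ys =
    Fin.injective⇒≤ {f = λ i → index (xs⊆ys (∈-lookup {xs = xs} i))} λ {i} {j} eq →
      lookup-injective xs! (trans (Any.lookup-index (xs⊆ys (∈-lookup i)))
        (trans (cong (lookup ys) eq) (sym (Any.lookup-index (xs⊆ys (∈-lookup j))))))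

  length≤1 : {xs : List A} → Unique xs → (∀ {x y} → x ∈ xs → y ∈ xs → x ≡ y) → length xs ≤ 1
  length≤1 {[]}         _                   _  = z≤n
  length≤1 {x ∷ []}     _                   _  = ≤-refl
  length≤1 {x ∷ y ∷ xs} ((x≢y ∷ _) ∷ _) eq =
    contradiction (eq (here refl) (there (here refl))) x≢y

  ∃∈-length : {xs : List A} {m : ℕ} → length xs ≡ suc m → ∃ (_∈ xs)
  ∃∈-length {x ∷ xs} _ = x , here refl

length-cartesianProductWith : {A B C : Set} (f : A → B → C) (xs : List A) (ys : List B) →
  length (cartesianProductWith f xs ys) ≡ length xs * length ys
length-cartesianProductWith f []       ys = refl
length-cartesianProductWith f (x ∷ xs) ys =
  trans (List.length-++ (map (f x) ys))
    (cong₂ _+_ (List.length-map (f x) ys) (length-cartesianProductWith f xs ys))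

sum-replicate : ∀ m k → sum (replicate m k) ≡ m * k
sum-replicate zero    k = refl
sum-replicate (suc m) k = cong (k +_) (sum-replicate m k)

-- Maximum sets of a majority-closed family

module SetFamily {X Y : Set} (_≟X_ : DecidableEquality X)
                 (_∋_ : Y → X → Set) (_∋?_ : Decidable _∋_) where

  trace : Y → List X → List X
  trace A = filter (A ∋?_)

  ∣_∩_∣ : Y → List X → ℕ
  ∣ A ∩ V ∣ = length (trace A V)

  star : X → List Y → List Y
  star v = filter (_∋? v)

  -- Only the half of majority that serves to enlarge sets: `D` has to contain the pairwise
  -- intersections and may contain more.
  MajorityClosed : (Y → Set) → Set
  MajorityClosed P = ∀ {A B C} → P A → P B → P C → ∃ λ D → P D ×
    (∀ {x} → A ∋ x → B ∋ x → D ∋ x) ×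
    (∀ {x} → A ∋ x → C ∋ x → D ∋ x) ×
    (∀ {x} → B ∋ x → C ∋ x → D ∋ x)

  -- The elements of `S` are absorbed one at a time. If `C` contains `v` and the tail of `S`, and
  -- `B′` contains `x` and `v`, the majority of `A`, `C`, `B′` gets `v` from `C` and `B′`, `x` from
  -- `A` and `B′`, and the tail from `A` and `C`.
  enlarge : {P : Y → Set} → MajorityClosed P → ∀ {A B v} → P A → P B → B ∋ v → (S : List X) →
            All (λ x → A ∋ x × ∃ λ B → P B × B ∋ x × B ∋ v) S →
            ∃ λ C → P C × C ∋ v × All (C ∋_) S
  enlarge maj {B = B} pA pB Bv [] [] = B , pB , Bv , []
  enlarge maj pA pB Bv (x ∷ S) ((Ax , B′ , pB′ , B′x , B′v) ∷ hS)
    with enlarge maj pA pB Bv S hS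
  ... | C , pC , Cv , CS with maj pA pC pB′
  ... | D , pD , AC , AB′ , CB′ =
    D , pD , CB′ Cv B′v , AB′ Ax B′x ∷ All.zipWith (λ (a , c) → AC a c) (All.map proj₁ hS , CS)

  -- Peel off `w`: at most `m` sets contain it, and the others must be met by the rest of `W`.
  -- Passing to a part of `L` only lowers the counts through each element.
  length≤-cover : (L : List Y) (W : List X) (m : ℕ) →
                  (∀ {A} → A ∈ L → Any (A ∋_) W) →
                  (∀ {w} → w ∈ W → length (star w L) ≤ m) →
                  length L ≤ length W * m
  length≤-cover [] W m _ _ = z≤n
  length≤-cover (A ∷ L) [] m cover _ with cover (here refl)
  ... | ()
  length≤-cover L@(_ ∷ _) (w ∷ W) m cover bound = begin
    length L                     ≡⟨ ↭-length (↭-filter-++ (_∋? w) L) ⟩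
    length (star w L ++ L′)      ≡⟨ List.length-++ (star w L) ⟩
    length (star w L) + length L′ ≤⟨ +-mono-≤ (bound (here refl))
                                       (length≤-cover L′ W m cover′ bound′) ⟩
    m + length W * m             ∎
    where
    open ≤-Reasoning
    L′ = filter (¬? ∘ (_∋? w)) L
    cover′ : ∀ {A} → A ∈ L′ → Any (A ∋_) W
    cover′ A∈L′ with ∈-filter⁻ (¬? ∘ (_∋? w)) A∈L′
    ... | A∈L , A∌w with cover A∈L
    ... | here A∋w = contradiction A∋w A∌w
    ... | there any = any
    bound′ : ∀ {u} → u ∈ W → length (star u L′) ≤ m
    bound′ {u} u∈W = begin
      length (star u L′)                                  ≤⟨ m≤n+m _ _ ⟩
      length (star u (star w L)) + length (star u L′)     ≡⟨ length-filter-split (_∋? w) (_∋? u) L ⟨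
      length (star u L)                                   ≤⟨ bound (there u∈W) ⟩
      m                                                   ∎

  ∣∩∣>0 : ∀ {A x V} → x ∈ V → A ∋ x → 1 ≤ ∣ A ∩ V ∣
  ∣∩∣>0 {A} x∈V A∋x = ∈-length (∈-filter⁺ (A ∋?_) x∈V A∋x)

  -- V′ and W are as in the header, and L′ lists the sets of L through v.
  module Link
    {d : ℕ} {V : List X} (V! : Unique V)
    {P : Y → Set} (maj : MajorityClosed P) (P≤ : ∀ {A} → P A → ∣ A ∩ V ∣ ≤ suc d)
    {L : List Y} (hL : ∀ {A} → A ∈ L → P A × ∣ A ∩ V ∣ ≡ suc d)
    (sep : ∀ {A B} → A ∈ L → B ∈ L →
      (∀ {x} → x ∈ V → (A ∋ x → B ∋ x) × (B ∋ x → A ∋ x)) → A ≡ B)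
    {v : X} (v∈V : v ∈ V) where

    open ≤-Reasoning

    N : X → Set
    N u = u ≢ v × Any (λ A → A ∋ u × A ∋ v) L

    N? : U.Decidable N
    N? u = ¬? (u ≟X v) ×-dec any? (λ A → (A ∋? u) ×-dec (A ∋? v)) L

    V′ W : List X
    V′ = filter N? V
    W  = filter (¬? ∘ N?) V

    v∈W : v ∈ W
    v∈W = ∈-filter⁺ (¬? ∘ N?) v∈V (λ (v≢v , _) → v≢v refl)

    P′ : Y → Set
    P′ A = P A × A ∋ v

    maj′ : MajorityClosed P′
    maj′ (pA , Av) (pB , Bv) (pC , Cv) with maj pA pB pC
    ... | D , pD , AB , AC , BC = D , (pD , AB Av Bv) , AB , AC , BC

    -- Since `v` lies in `W`, each set of `P′` loses at least one element when `V` shrinks to `V′`.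
    P′≤ : ∀ {A} → P′ A → ∣ A ∩ V′ ∣ ≤ d
    P′≤ {A} (pA , Av) = +-cancelʳ-≤ 1 _ _ (begin
      ∣ A ∩ V′ ∣ + 1          ≤⟨ +-monoʳ-≤ _ (∣∩∣>0 v∈W Av) ⟩
      ∣ A ∩ V′ ∣ + ∣ A ∩ W ∣  ≡⟨ length-filter-split N? (A ∋?_) V ⟨
      ∣ A ∩ V ∣               ≤⟨ P≤ pA ⟩
      suc d                   ≡⟨ +-comm 1 d ⟩
      d + 1                   ∎)

    L′ : List Y
    L′ = star v L

    only-v : ∀ {A x} → A ∈ L → A ∋ v → ¬ N x → A ∋ x → x ≡ v
    only-v {x = x} A∈L Av ¬Nx Ax =
      decidable-stable (x ≟X v) λ x≢v → ¬Nx (x≢v , lose A∈L (Ax , Av))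

    -- Whatever a maximum set through `v` contains in `V` besides `v` satisfies `N`. So exactly one
    -- element is lost, and the set is again maximum on `V′`.
    ∣∩W∣≡1 : ∀ {A} → A ∈ L → A ∋ v → ∣ A ∩ W ∣ ≡ 1
    ∣∩W∣≡1 {A} A∈L Av = ≤-antisym
      (length≤1 (Unique.filter⁺ (A ∋?_) (Unique.filter⁺ (¬? ∘ N?) V!))
        λ x∈ y∈ → trans (≡v x∈) (sym (≡v y∈)))
      (∣∩∣>0 v∈W Av)
      where
      ≡v : ∀ {x} → x ∈ trace A W → x ≡ v
      ≡v x∈ with ∈-filter⁻ (A ∋?_) x∈
      ... | x∈W , Ax = only-v A∈L Av (proj₂ (∈-filter⁻ (¬? ∘ N?) {xs = V} x∈W)) Ax

    hL′ : ∀ {A} → A ∈ L′ → P′ A × ∣ A ∩ V′ ∣ ≡ d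
    hL′ {A} A∈L′ with ∈-filter⁻ (_∋? v) A∈L′
    ... | A∈L , Av = (proj₁ (hL A∈L) , Av) , +-cancelʳ-≡ 1 _ _ (begin-equality
      ∣ A ∩ V′ ∣ + 1          ≡⟨ cong (∣ A ∩ V′ ∣ +_) (∣∩W∣≡1 A∈L Av) ⟨
      ∣ A ∩ V′ ∣ + ∣ A ∩ W ∣  ≡⟨ length-filter-split N? (A ∋?_) V ⟨
      ∣ A ∩ V ∣               ≡⟨ proj₂ (hL A∈L) ⟩
      suc d                   ≡⟨ +-comm 1 d ⟩
      d + 1                   ∎)

    -- Outside `V′`, two maximum sets through `v` both contain just `v`, so agreement on `V′`
    -- extends to all of `V`.
    sep′ : ∀ {A B} → A ∈ L′ → B ∈ L′ →
           (∀ {x} → x ∈ V′ → (A ∋ x → B ∋ x) × (B ∋ x → A ∋ x)) → A ≡ B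
    sep′ {A} {B} A∈L′ B∈L′ A≈B
      with ∈-filter⁻ (_∋? v) A∈L′ | ∈-filter⁻ (_∋? v) B∈L′
    ... | A∈L , Av | B∈L , Bv = sep A∈L B∈L agree
      where
      agree : ∀ {x} → x ∈ V → (A ∋ x → B ∋ x) × (B ∋ x → A ∋ x)
      agree {x} x∈V with N? x
      ... | yes Nx = A≈B (∈-filter⁺ N? x∈V Nx)
      ... | no ¬Nx = (λ Ax → subst (B ∋_) (sym (only-v A∈L Av ¬Nx Ax)) Bv) ,
                     (λ Bx → subst (A ∋_) (sym (only-v B∈L Bv ¬Nx Bx)) Av)

    cover : ∀ {A} → A ∈ L → Any (A ∋_) W
    cover {A} A∈L = decidable-stable (any? (A ∋?_) W) enlargeable
      where
      S : List X
      S = trace A V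

      S⁻ : ∀ {x} → x ∈ S → x ∈ V × A ∋ x
      S⁻ = ∈-filter⁻ (A ∋?_) {xs = V}

      module _ (¬meets : ¬ Any (A ∋_) W) where

        S⊆N : ∀ {x} → x ∈ S → N x
        S⊆N {x} x∈S = decidable-stable (N? x) λ ¬Nx →
          ¬meets (lose (∈-filter⁺ (¬? ∘ N?) (proj₁ (S⁻ x∈S)) ¬Nx) (proj₂ (S⁻ x∈S)))

        joined : ∀ {x} → x ∈ S → ∃ λ B → P B × B ∋ x × B ∋ v
        joined x∈S with find (proj₂ (S⊆N x∈S))
        ... | B , B∈L , Bx , Bv = B , proj₁ (hL B∈L) , Bx , Bv

        v∉S : All (v ≢_) S
        v∉S = All.tabulate λ { x∈S refl → proj₁ (S⊆N x∈S) refl }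

        enlargeable : ⊥
        enlargeable
          -- `A` has `suc d` elements in `V`, so `S` is nonempty and one of its elements supplies
          -- the set through `v` from which `enlarge` starts.
          with B , pB , _ , Bv ← joined (proj₂ (∃∈-length (proj₂ (hL A∈L))))
          with C , pC , Cv , C⊇S ← enlarge maj (proj₁ (hL A∈L)) pB Bv S
                 (All.tabulate λ x∈S → proj₂ (S⁻ x∈S) , joined x∈S)
          -- As `v` is not in `S`, the set `C` has at least `d + 2` elements in `V`, which is too
          -- many.
          = <⇒≱ (s≤s (≤-reflexive (sym (proj₂ (hL A∈L))))) (begin
              length (v ∷ S)  ≤⟨ length-mono-⊆ (v∉S ∷ Unique.filter⁺ (A ∋?_) V!) (λ
                                   { (here refl) → ∈-filter⁺ (C ∋?_) v∈V Cv
                                   ; (there x∈S) →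
                                       ∈-filter⁺ (C ∋?_) (proj₁ (S⁻ x∈S)) (All.lookup C⊇S x∈S) }) ⟩
              ∣ C ∩ V ∣       ≤⟨ P≤ pC ⟩
              suc d           ∎)

  -- The factors are returned as a list, so that optimising their product is a separate matter. The
  -- sets remain the same members of `Y` while `V` shrinks; hence the last hypothesis, that a set of
  -- `L` is determined by its trace on `V`, is carried through the induction.
  maximumSets-bound :
    (d : ℕ) {V : List X} → Unique V →
    {P : Y → Set} → MajorityClosed P → (∀ {A} → P A → ∣ A ∩ V ∣ ≤ d) →
    (L : List Y) → Unique L → (∀ {A} → A ∈ L → P A × ∣ A ∩ V ∣ ≡ d) →
    (∀ {A B} → A ∈ L → B ∈ L →
      (∀ {x} → x ∈ V → (A ∋ x → B ∋ x) × (B ∋ x → A ∋ x)) → A ≡ B) →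
    ∃ λ xs → length xs ≡ d × sum xs ≤ length V × length L ≤ product xs
  maximumSets-bound zero {V} V! maj P≤ L L! hL sep =
    -- All traces are empty, so at most one set is left, in accordance with the empty product.
    [] , refl , z≤n , length≤1 L! λ A∈L B∈L → sep A∈L B∈L λ x∈V →
      (λ A∋x → contradiction A∋x (empty A∈L x∈V)) , λ B∋x → contradiction B∋x (empty B∈L x∈V)
    where
    empty : ∀ {A x} → A ∈ L → x ∈ V → ¬ A ∋ x
    empty A∈L x∈V A∋x = <⇒≱ (∣∩∣>0 x∈V A∋x) (≤-reflexive (proj₂ (hL A∈L)))
  maximumSets-bound (suc d) V! maj P≤ [] L! hL sep =
    -- With no set to count, zeros keep the sum within every bound.
    replicate (suc d) 0 , List.length-replicate (suc d) ,
    ≤-trans (≤-reflexive (trans (sum-replicate d 0) (*-zeroʳ d))) z≤n , z≤n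
  maximumSets-bound (suc d) {V} V! maj P≤ L@(A₀ ∷ _) L! hL sep =
    let xs , length-xs , sum-xs , L′≤ =
          maximumSets-bound d (Unique.filter⁺ N? V!) maj′ P′≤
            L′ (Unique.filter⁺ (_∋? v) L!) hL′ sep′
    in length W ∷ xs , cong suc length-xs ,
       (begin
         length W + sum xs      ≤⟨ +-monoʳ-≤ (length W) sum-xs ⟩
         length W + length V′   ≡⟨ +-comm (length W) _ ⟩
         length V′ + length W   ≡⟨ List.length-++ V′ ⟨
         length (V′ ++ W)       ≡⟨ ↭-length (↭-filter-++ N? V) ⟨
         length V               ∎) ,
       (begin
         length L               ≤⟨ length≤-cover L W (c v) cover
                                     (λ w∈W → c≤cv (proj₁ (∈-filter⁻ (¬? ∘ N?) w∈W))) ⟩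
         length W * c v         ≤⟨ *-monoʳ-≤ (length W) L′≤ ⟩
         length W * product xs  ∎)
    where
    c : X → ℕ
    c u = length (star u L)

    v₀ : ∃ (_∈ trace A₀ V)
    v₀ = ∃∈-length (proj₂ (hL (here refl)))

    v : X
    -- The default value is taken from `A₀` inside `V`, so the maximiser lies in `V` whichever way
    -- it arises.
    v = argmax c (proj₁ v₀) V

    v∈V : v ∈ V
    v∈V with argmax-sel c (proj₁ v₀) V
    ... | inj₁ v≡v₀ = subst (_∈ V) (sym v≡v₀) (proj₁ (∈-filter⁻ (A₀ ∋?_) (proj₂ v₀)))
    ... | inj₂ v∈V  = v∈V

    c≤cv : ∀ {u} → u ∈ V → c u ≤ c v
    c≤cv = All.lookup (f[xs]≤f[argmax] (proj₁ v₀) V)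

    open ≤-Reasoning
    open Link V! maj P≤ hL sep v∈V

-- The product of naturals with given sum

-- x / q ≤ (1 + 1 / q) ^ (x − q) with denominators cleared: a convex function lies above its
-- chord over [q , q + 1] at every integer x.  Equality holds at x = q and x = q + 1, so
-- multiplying over all factors loses nothing when they are as equal as possible.
module _ (q : ℕ) where

  -- Upward induction from equality at `x = q`. Going from `x` to `x + 1` multiplies the right side
  -- by `q + 1` and replaces `x` by `q * (x + 1)` on the left, which is at most `(q + 1) * x`
  -- because `q ≤ x`.
  factor-bound-≥ : ∀ k → (k + q) * (q ^ (k + q) * suc q ^ q) ≤ q ^ suc q * suc q ^ (k + q)
  factor-bound-≥ zero    = ≤-reflexive (sym (*-assoc q (q ^ q) (suc q ^ q)))
  factor-bound-≥ (suc k) = begin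
    suc x * (q * a * b)   ≡⟨ solve 4 (λ x q a b → (con 1 :+ x) :* (q :* a :* b) :=
                                        (q :+ x :* q) :* (a :* b)) refl x q a b ⟩
    (q + x * q) * (a * b) ≤⟨ *-monoˡ-≤ (a * b) (+-monoˡ-≤ (x * q) (m≤n+m q k)) ⟩
    (x + x * q) * (a * b) ≡⟨ solve 4 (λ x q a b → (x :+ x :* q) :* (a :* b) :=
                                        (con 1 :+ q) :* (x :* (a :* b))) refl x q a b ⟩
    suc q * (x * (a * b)) ≤⟨ *-monoʳ-≤ (suc q) (factor-bound-≥ k) ⟩
    suc q * (e * c)       ≡⟨ solve 3 (λ p e c → p :* (e :* c) := e :* (p :* c)) refl (suc q) e c ⟩
    e * (suc q * c)       ∎
    where
    open ≤-Reasoning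
    open +-*-Solver
    x = k + q
    a = q ^ x
    b = suc q ^ q
    c = suc q ^ x
    e = q ^ suc q

  -- Downward induction from `x = q`, with `k` the distance still to go: now
  -- `(q + 1) * x ≤ q * (x + 1)`, and the factor `q + 1` is cancelled at the end.
  factor-bound-≤ : ∀ k x → k + x ≡ q → x * (q ^ x * suc q ^ q) ≤ q ^ suc q * suc q ^ x
  factor-bound-≤ zero    x refl = factor-bound-≥ 0
  factor-bound-≤ (suc k) x k+x≡q = *-cancelˡ-≤ (suc q) (begin
    suc q * (x * (a * b)) ≡⟨ solve 4 (λ x q a b → (con 1 :+ q) :* (x :* (a :* b)) :=
                                        (x :+ x :* q) :* (a :* b)) refl x q a b ⟩
    (x + x * q) * (a * b) ≤⟨ *-monoˡ-≤ (a * b) (+-monoˡ-≤ (x * q) x≤q) ⟩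
    (q + x * q) * (a * b) ≡⟨ solve 4 (λ x q a b → (q :+ x :* q) :* (a :* b) :=
                                        (con 1 :+ x) :* (q :* a :* b)) refl x q a b ⟩
    suc x * (q * a * b)   ≤⟨ factor-bound-≤ k (suc x) (trans (+-suc k x) k+x≡q) ⟩
    e * (suc q * c)       ≡⟨ solve 3 (λ p e c → e :* (p :* c) := p :* (e :* c)) refl (suc q) e c ⟩
    suc q * (e * c)       ∎)
    where
    open ≤-Reasoning
    open +-*-Solver
    x≤q : x ≤ q
    x≤q = ≤-trans (m≤n+m x (suc k)) (≤-reflexive k+x≡q)
    a = q ^ x
    b = suc q ^ q
    c = suc q ^ x
    e = q ^ suc q

  factor-bound : ∀ x → x * (q ^ x * suc q ^ q) ≤ q ^ suc q * suc q ^ x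
  factor-bound x with ≤-total q x
  ... | inj₁ q≤x = subst (λ x → x * (q ^ x * suc q ^ q) ≤ q ^ suc q * suc q ^ x)
                     (m∸n+n≡m q≤x) (factor-bound-≥ (x ∸ q))
  ... | inj₂ x≤q = factor-bound-≤ (q ∸ x) x (m∸n+n≡m x≤q)

  factors-bound : ∀ xs → product xs * (q ^ sum xs * (suc q ^ q) ^ length xs) ≤
                         (q ^ suc q) ^ length xs * suc q ^ sum xs
  factors-bound [] = ≤-refl
  factors-bound (x ∷ xs) = begin
    x * π * (q ^ (x + s) * (b * B))
      ≡⟨ cong (λ y → x * π * (y * (b * B))) (^-distribˡ-+-* q x s) ⟩
    x * π * (q ^ x * q ^ s * (b * B))
      ≡⟨ solve 6 (λ x π a A b B → x :* π :* (a :* A :* (b :* B)) :=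
                                  x :* (a :* b) :* (π :* (A :* B))) refl x π (q ^ x) (q ^ s) b B ⟩
    x * (q ^ x * b) * (π * (q ^ s * B))
      ≤⟨ *-mono-≤ (factor-bound x) (factors-bound xs) ⟩
    e * suc q ^ x * (E * suc q ^ s)
      ≡⟨ solve 4 (λ e a E A → e :* a :* (E :* A) := e :* E :* (a :* A))
           refl e (suc q ^ x) E (suc q ^ s) ⟩
    e * E * (suc q ^ x * suc q ^ s)
      ≡⟨ cong (e * E *_) (^-distribˡ-+-* (suc q) x s) ⟨
    e * E * suc q ^ (x + s) ∎
    where
    open ≤-Reasoning
    open +-*-Solver
    π = product xs
    s = sum xs
    b = suc q ^ q
    B = (suc q ^ q) ^ length xs
    e = q ^ suc q
    E = (q ^ suc q) ^ length xs

  -- For sum exactly `S` the claim is `factors-bound` divided by the positive number `q ^ S * B`. A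
  -- smaller sum falls short by `z`, and both sides are first brought up to exponent `S`.
  product≤ : .{{NonZero q}} → ∀ e r xs → length xs ≡ e + r → sum xs ≤ (e + r) * q + r →
             product xs ≤ q ^ e * suc q ^ r
  product≤ e r xs length-xs sum-xs = *-cancelʳ-≤ _ _ (q ^ S * B)
    {{m*n≢0 _ _ {{m^n≢0 q S}} {{m^n≢0 (suc q ^ q) d {{m^n≢0 (suc q) q}}}}}} (begin
      π * (q ^ S * B)                ≡⟨ cong (λ y → π * (q ^ y * B)) s+z≡S ⟨
      π * (q ^ (s + z) * B)          ≡⟨ cong (λ y → π * (y * B)) (^-distribˡ-+-* q s z) ⟩
      π * (q ^ s * q ^ z * B)        ≡⟨ solve 4 (λ π a c B → π :* (a :* c :* B) := π :* (a :* B) :* c)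
                                          refl π (q ^ s) (q ^ z) B ⟩
      -- The shortfall `z` is paid for by `q ^ z ≤ suc q ^ z`.
      π * (q ^ s * B) * q ^ z        ≤⟨ *-mono-≤ bound (^-monoˡ-≤ z (n≤1+n q)) ⟩
      E * suc q ^ s * suc q ^ z      ≡⟨ *-assoc E _ _ ⟩
      E * (suc q ^ s * suc q ^ z)    ≡⟨ cong (E *_) (^-distribˡ-+-* (suc q) s z) ⟨
      E * suc q ^ (s + z)            ≡⟨ cong₂ _*_ E≡ (trans (cong (suc q ^_) s+z≡S)
                                          (trans (^-distribˡ-+-* (suc q) (d * q) r) (cong (_* suc q ^ r) B≡))) ⟩
      q ^ e * q ^ r * q ^ (d * q) * (B * suc q ^ r)
        ≡⟨ solve 5 (λ a b c B p → a :* b :* c :* (B :* p) := a :* p :* (c :* b :* B))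
             refl (q ^ e) (q ^ r) (q ^ (d * q)) B (suc q ^ r) ⟩
      q ^ e * suc q ^ r * (q ^ (d * q) * q ^ r * B)
        ≡⟨ cong (λ y → q ^ e * suc q ^ r * (y * B)) (^-distribˡ-+-* q (d * q) r) ⟨
      q ^ e * suc q ^ r * (q ^ S * B) ∎)
    where
    open ≤-Reasoning
    open +-*-Solver
    d = e + r
    S = d * q + r
    π = product xs
    s = sum xs
    z = S ∸ s
    B = (suc q ^ q) ^ d
    E = (q ^ suc q) ^ d
    s+z≡S : s + z ≡ S
    s+z≡S = m+[n∸m]≡n sum-xs
    bound : π * (q ^ s * B) ≤ E * suc q ^ s
    bound = subst (λ l → π * (q ^ s * (suc q ^ q) ^ l) ≤ (q ^ suc q) ^ l * suc q ^ s)
              length-xs (factors-bound xs)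
    E≡ : E ≡ q ^ e * q ^ r * q ^ (d * q)
    E≡ = trans (^-*-assoc q (suc q) d) (trans (cong (q ^_) (*-comm (suc q) d))
      (trans (cong (q ^_) (*-suc d q)) (trans (^-distribˡ-+-* q d (d * q))
        (cong (_* q ^ (d * q)) (^-distribˡ-+-* q e r)))))
    B≡ : suc q ^ (d * q) ≡ B
    B≡ = trans (cong (suc q ^_) (*-comm d q)) (sym (^-*-assoc (suc q) q d))

-- Solutions of a 2-CNF

zeros : ∀ {n} → Assignment n → Fin n → Set
zeros a i = Vec.lookup a i ≡ false

zeros? : ∀ {n} → Decidable (zeros {n})
zeros? a i = Vec.lookup a i Bool.≟ false

module _ {n : ℕ} where
  open SetFamily {X = Fin n} Fin._≟_ zeros zeros? public

-- The tail of a `tabulate` of `f` is the `tabulate` of `f ∘ suc`, so the induction on `a` needs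
-- arbitrary `f` and a fixed test `g` in place of the lookup.
length-filter-zeros : ∀ {X : Set} {n} (g : X → Bool) (f : Fin n → X) (a : Assignment n) →
  (∀ i → g (f i) ≡ Vec.lookup a i) →
  length (filter (λ x → g x Bool.≟ false) (tabulate f)) + weight a ≡ n
length-filter-zeros g f Vec.[] eq = refl
length-filter-zeros g f (b Vec.∷ a) eq with g (f zero) | eq zero
... | false | refl = cong suc (length-filter-zeros g (f ∘ suc) a (eq ∘ suc))
... | true  | refl = trans (+-suc _ _) (cong suc (length-filter-zeros g (f ∘ suc) a (eq ∘ suc)))

∣zeros∣+weight : ∀ {n} (a : Assignment n) → ∣ a ∩ allFin n ∣ + weight a ≡ n
∣zeros∣+weight a = length-filter-zeros (Vec.lookup a) id a λ _ → refl

zeros-injective : ∀ {n} {a b : Assignment n} →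
  (∀ i → (zeros a i → zeros b i) × (zeros b i → zeros a i)) → a ≡ b
zeros-injective {a = a} {b} eq =
  trans (sym (Vec.tabulate∘lookup a)) (trans (Vec.tabulate-cong agree) (Vec.tabulate∘lookup b))
  where
  agree : Vec.lookup a ≗ Vec.lookup b
  agree i with Vec.lookup a i | Vec.lookup b i | eq i
  ... | false | _     | f , _ = sym (f refl)
  ... | true  | true  | _     = refl
  ... | true  | false | _ , g = g refl

-- Coordinatewise majority of assignments

maj : Bool → Bool → Bool → Bool
maj false false _ = false
maj false true  z = z
maj true  false z = z
maj true  true  _ = true

maj₁₂ : ∀ {w} x y z → x ≡ w → y ≡ w → maj x y z ≡ w
maj₁₂ false _ _ refl refl = refl
maj₁₂ true  _ _ refl refl = refl

maj₁₃ : ∀ {w} x y z → x ≡ w → z ≡ w → maj x y z ≡ w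
maj₁₃ false false _ refl refl = refl
maj₁₃ false true  _ refl refl = refl
maj₁₃ true  false _ refl refl = refl
maj₁₃ true  true  _ refl refl = refl

maj₂₃ : ∀ {w} x y z → y ≡ w → z ≡ w → maj x y z ≡ w
maj₂₃ false false _ refl refl = refl
maj₂₃ false true  _ refl refl = refl
maj₂₃ true  false _ refl refl = refl
maj₂₃ true  true  _ refl refl = refl

module _ {n : ℕ} (a b c : Assignment n) where

  majority : Assignment n
  majority = Vec.tabulate λ i → maj (Vec.lookup a i) (Vec.lookup b i) (Vec.lookup c i)

  lookup-majority₁₂ : ∀ {w} i → Vec.lookup a i ≡ w → Vec.lookup b i ≡ w → Vec.lookup majority i ≡ w
  lookup-majority₁₂ i p q = trans (Vec.lookup∘tabulate _ i) (maj₁₂ _ _ _ p q)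

  lookup-majority₁₃ : ∀ {w} i → Vec.lookup a i ≡ w → Vec.lookup c i ≡ w → Vec.lookup majority i ≡ w
  lookup-majority₁₃ i p q = trans (Vec.lookup∘tabulate _ i) (maj₁₃ (Vec.lookup a i) _ _ p q)

  lookup-majority₂₃ : ∀ {w} i → Vec.lookup b i ≡ w → Vec.lookup c i ≡ w → Vec.lookup majority i ≡ w
  lookup-majority₂₃ i p q = trans (Vec.lookup∘tabulate _ i) (maj₂₃ (Vec.lookup a i) _ _ p q)

  literal₁₂ : ∀ l → LiteralTrue a l → LiteralTrue b l → LiteralTrue majority l
  literal₁₂ (pos i) = lookup-majority₁₂ i
  literal₁₂ (neg i) = lookup-majority₁₂ i

  literal₁₃ : ∀ l → LiteralTrue a l → LiteralTrue c l → LiteralTrue majority l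
  literal₁₃ (pos i) = lookup-majority₁₃ i
  literal₁₃ (neg i) = lookup-majority₁₃ i

  literal₂₃ : ∀ l → LiteralTrue b l → LiteralTrue c l → LiteralTrue majority l
  literal₂₃ (pos i) = lookup-majority₂₃ i
  literal₂₃ (neg i) = lookup-majority₂₃ i

  -- Three assignments each make one of at most two literals true, so two of them share a true
  -- literal, and the majority inherits it.
  clause-majority : ∀ C → width C ≤ 2 → Any (LiteralTrue a) C → Any (LiteralTrue b) C →
                    Any (LiteralTrue c) C → Any (LiteralTrue majority) C
  clause-majority (l ∷ []) _ (here p) (here q) _ = here (literal₁₂ l p q)
  clause-majority (l ∷ m ∷ []) _ (here p) (here q) _ = here (literal₁₂ l p q)
  clause-majority (l ∷ m ∷ []) _ (here p) (there _) (here r) = here (literal₁₃ l p r)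
  clause-majority (l ∷ m ∷ []) _ (there _) (here q) (here r) = here (literal₂₃ l q r)
  clause-majority (l ∷ m ∷ []) _ (there (here p)) (there (here q)) _ =
    there (here (literal₁₂ m p q))
  clause-majority (l ∷ m ∷ []) _ (there (here p)) (here _) (there (here r)) =
    there (here (literal₁₃ m p r))
  clause-majority (l ∷ m ∷ []) _ (here _) (there (here q)) (there (here r)) =
    there (here (literal₂₃ m q r))
  clause-majority (_ ∷ _ ∷ _ ∷ _) (s≤s (s≤s ())) _ _ _

  ⊨-majority : ∀ F → F IsCNFOfWidth≤ 2 → a ⊨ F → b ⊨ F → c ⊨ F → majority ⊨ F
  ⊨-majority [] [] [] [] [] = []
  ⊨-majority (C ∷ F) (w ∷ ws) (p ∷ ps) (q ∷ qs) (r ∷ rs) =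
    clause-majority C w p q r ∷ ⊨-majority F ws ps qs rs

-- The upper bound for a 2-CNF

∈-sat⁻ : ∀ {n t} {F : CNF n} {a} → a ∈ sat t F → a ⊨ F × weight a ≡ t
∈-sat⁻ {n} {t} {F} a∈ =
  proj₂ (∈-filter⁻ (λ a → (a ⊨? F) ×-dec (weight a ≟ t)) {xs = assignments n} a∈)

∈-sat⁺ : ∀ {n t} {F : CNF n} {a} → a ⊨ F → weight a ≡ t → a ∈ sat t F
∈-sat⁺ {t = t} {F} {a} a⊨F wa =
  ∈-filter⁺ (λ a → (a ⊨? F) ×-dec (weight a ≟ t)) (∈-assignments a) (a⊨F , wa)

-- The family consists of the zero sets of all solutions. Admissibility caps their size at `n ∸ t`,
-- so the solutions of weight `t` are sets of the maximum allowed size.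
#sat≤product : ∀ {n} t (F : CNF n) → F IsCNFOfWidth≤ 2 → Admissible t F → t ≤ n →
               ∃ λ xs → length xs ≡ n ∸ t × sum xs ≤ n × #sat t F ≤ product xs
#sat≤product {n} t F F₂ adm t≤n =
  let xs , length-xs , sum-xs , bound =
        maximumSets-bound (n ∸ t) (Unique.allFin⁺ n)
          (λ {a} {b} {c} p q r → majority a b c , ⊨-majority a b c F F₂ p q r ,
             (λ {i} → lookup-majority₁₂ a b c i) ,
             (λ {i} → lookup-majority₁₃ a b c i) ,
             (λ {i} → lookup-majority₂₃ a b c i))
          few-zeros (sat t F)
          (Unique.filter⁺ (λ a → (a ⊨? F) ×-dec (weight a ≟ t)) (assignments-unique n))
          (λ {a} a∈ → let a⊨F , wa = ∈-sat⁻ {F = F} a∈ in a⊨F ,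
             trans (sym (m+n∸n≡m _ t))
               (cong (_∸ t) (trans (cong (∣ a ∩ allFin n ∣ +_) (sym wa)) (∣zeros∣+weight a))))
          (λ _ _ eq → zeros-injective λ i → eq (∈-allFin i))
  in
  xs , length-xs , ≤-trans sum-xs (≤-reflexive (List.length-tabulate id)) , bound
  where
  open ≤-Reasoning
  few-zeros : ∀ {a} → a ⊨ F → ∣ a ∩ allFin n ∣ ≤ n ∸ t
  few-zeros {a} a⊨F = +-cancelʳ-≤ t _ _ (begin
    ∣ a ∩ allFin n ∣ + t         ≤⟨ +-monoʳ-≤ _ (≮⇒≥ λ wa<t → adm (a , a⊨F , wa<t)) ⟩
    ∣ a ∩ allFin n ∣ + weight a  ≡⟨ ∣zeros∣+weight a ⟩
    n                            ≡⟨ m∸n+n≡m t≤n ⟨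
    n ∸ t + t                    ∎)

-- The extremal formula

module _ {m n : ℕ} (ρ : Fin m → Fin n) where

  renameLiteral : Literal m → Literal n
  renameLiteral (pos i) = pos (ρ i)
  renameLiteral (neg i) = neg (ρ i)

  rename : CNF m → CNF n
  rename = map (map renameLiteral)

  rename-width : ∀ {k} F → F IsCNFOfWidth≤ k → rename F IsCNFOfWidth≤ k
  rename-width F F≤k =
    All.map⁺ (All.map (λ {C} → ≤-trans (≤-reflexive (List.length-map renameLiteral C))) F≤k)

  module _ {a : Assignment m} {b : Assignment n}
           (b∘ρ≗a : ∀ i → Vec.lookup b (ρ i) ≡ Vec.lookup a i) where

    renameLiteral⁺ : ∀ {l} → LiteralTrue a l → LiteralTrue b (renameLiteral l)
    renameLiteral⁺ {pos i} = trans (b∘ρ≗a i)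
    renameLiteral⁺ {neg i} = trans (b∘ρ≗a i)

    renameLiteral⁻ : ∀ {l} → LiteralTrue b (renameLiteral l) → LiteralTrue a l
    renameLiteral⁻ {pos i} = trans (sym (b∘ρ≗a i))
    renameLiteral⁻ {neg i} = trans (sym (b∘ρ≗a i))

    ⊨-rename⁺ : ∀ {F} → a ⊨ F → b ⊨ rename F
    ⊨-rename⁺ a⊨F = All.map⁺ (All.map (Any.map⁺ ∘ Any.map (λ {l} → renameLiteral⁺ {l})) a⊨F)

    ⊨-rename⁻ : ∀ {F} → b ⊨ rename F → a ⊨ F
    ⊨-rename⁻ b⊨F = All.map (Any.map (λ {l} → renameLiteral⁻ {l}) ∘ Any.map⁻) (All.map⁻ b⊨F)

-- The formula on a single block

atMostOneZero : ∀ k → CNF k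
atMostOneZero zero    = []
atMostOneZero (suc k) =
  map (λ i → pos zero ∷ pos (suc i) ∷ []) (allFin k) ++ rename suc (atMostOneZero k)

atMostOneZero-width : ∀ k → atMostOneZero k IsCNFOfWidth≤ 2
atMostOneZero-width zero    = []
atMostOneZero-width (suc k) =
  All.++⁺ (All.map⁺ (All.tabulate λ _ → ≤-refl)) (rename-width suc _ (atMostOneZero-width k))

⊨-atMostOneZero-true⁺ : ∀ {k} {a : Assignment k} → a ⊨ atMostOneZero k →
                        (true Vec.∷ a) ⊨ atMostOneZero (suc k)
⊨-atMostOneZero-true⁺ a⊨ =
  All.++⁺ (All.map⁺ (All.tabulate λ _ → here refl)) (⊨-rename⁺ suc (λ _ → refl) a⊨)

ones : ∀ k → Assignment k
ones k = Vec.replicate k true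

weight-ones : ∀ k → weight (ones k) ≡ k
weight-ones zero    = refl
weight-ones (suc k) = cong suc (weight-ones k)

ones-⊨ : ∀ k → ones k ⊨ atMostOneZero k
ones-⊨ zero    = []
ones-⊨ (suc k) = ⊨-atMostOneZero-true⁺ (ones-⊨ k)

singleZero : ∀ k → List (Assignment k)
singleZero zero    = []
singleZero (suc k) = (false Vec.∷ ones k) ∷ map (true Vec.∷_) (singleZero k)

length-singleZero : ∀ k → length (singleZero k) ≡ k
length-singleZero zero    = refl
length-singleZero (suc k) =
  cong suc (trans (List.length-map _ (singleZero k)) (length-singleZero k))

singleZero-unique : ∀ k → Unique (singleZero k)
singleZero-unique zero    = []
singleZero-unique (suc k) =
  All.map⁺ (All.tabulate λ _ ()) ∷ Unique.map⁺ Vec.∷-injectiveʳ (singleZero-unique k)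

singleZero-weight : ∀ k → All (λ a → suc (weight a) ≡ k) (singleZero k)
singleZero-weight zero    = []
singleZero-weight (suc k) =
  cong suc (weight-ones k) ∷ All.map⁺ (All.map (cong suc) (singleZero-weight k))

singleZero-⊨ : ∀ k → All (_⊨ atMostOneZero k) (singleZero k)
singleZero-⊨ zero    = []
singleZero-⊨ (suc k) =
  -- The leading zero falsifies the first literal of each new clause; the second holds because all
  -- later variables are true.
  All.++⁺ (All.map⁺ (All.tabulate λ {i} _ → there (here (Vec.lookup-replicate i true))))
          (⊨-rename⁺ suc (λ _ → refl) (ones-⊨ k))
  ∷ All.map⁺ (All.map ⊨-atMostOneZero-true⁺ (singleZero-⊨ k))

-- A false head forces every later variable to be true through the clauses pairing it with them; a
-- true head leaves the question to the tail.
atMostOneZero-weight : ∀ {k} (a : Assignment k) → a ⊨ atMostOneZero k → k ≤ suc (weight a)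
atMostOneZero-weight Vec.[] _ = z≤n
atMostOneZero-weight {suc k} (true Vec.∷ a) a⊨ =
  s≤s (atMostOneZero-weight a (⊨-rename⁻ suc (λ _ → refl) (All.++⁻ʳ (map _ (allFin k)) a⊨)))
atMostOneZero-weight {suc k} (false Vec.∷ a) a⊨ =
  s≤s (≤-reflexive (sym (trans (cong weight a≡ones) (weight-ones k))))
  where
  true-rest : ∀ i → Vec.lookup a i ≡ true
  true-rest i with All.lookup (All.map⁻ (All.++⁻ˡ (map _ (allFin k)) a⊨)) (∈-allFin i)
  ... | there (here aᵢ) = aᵢ
  a≡ones : a ≡ ones k
  a≡ones = trans (sym (Vec.tabulate∘lookup a))
    (trans (Vec.tabulate-cong λ i → trans (true-rest i) (sym (Vec.lookup-replicate i true)))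
           (Vec.tabulate∘lookup (ones k)))

-- Concatenation of blocks

weight-++ : ∀ {m n} (a : Assignment m) (b : Assignment n) →
            weight (a Vec.++ b) ≡ weight a + weight b
weight-++ Vec.[]            b = refl
weight-++ (true Vec.∷ a)  b = cong suc (weight-++ a b)
weight-++ (false Vec.∷ a) b = weight-++ a b

blocks : ∀ xs → CNF (sum xs)
blocks []       = []
blocks (k ∷ ks) = rename (_↑ˡ sum ks) (atMostOneZero k) ++ rename (k ↑ʳ_) (blocks ks)

blocks-width : ∀ xs → blocks xs IsCNFOfWidth≤ 2
blocks-width []       = []
blocks-width (k ∷ ks) =
  All.++⁺ (rename-width _ _ (atMostOneZero-width k)) (rename-width _ _ (blocks-width ks))

-- Each block admits at most one zero, and these bounds add up over the pieces of `a`.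
blocks-weight : ∀ xs (a : Assignment (sum xs)) → a ⊨ blocks xs → sum xs ≤ length xs + weight a
blocks-weight []       Vec.[] _ = z≤n
blocks-weight (k ∷ ks) a a⊨ with Vec.splitAt k a
... | b , c , refl = begin
  k + sum ks
    ≤⟨ +-mono-≤
         (atMostOneZero-weight b (⊨-rename⁻ _ (Vec.lookup-++ˡ b c) (All.++⁻ˡ _ a⊨)))
         (blocks-weight ks c
           (⊨-rename⁻ _ (Vec.lookup-++ʳ b c) (All.++⁻ʳ (rename _ (atMostOneZero k)) a⊨))) ⟩
  suc (weight b) + (length ks + weight c)
    ≡⟨ solve 3 (λ b l c → con 1 :+ b :+ (l :+ c) := con 1 :+ l :+ (b :+ c))
         refl (weight b) (length ks) (weight c) ⟩
  suc (length ks) + (weight b + weight c)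
    ≡⟨ cong (suc (length ks) +_) (weight-++ b c) ⟨
  suc (length ks) + weight (b Vec.++ c) ∎
  where
  open ≤-Reasoning
  open +-*-Solver

-- One zero is chosen in each block, independently, which is where the product of the block sizes
-- comes from.
transversals : ∀ xs → List (Assignment (sum xs))
transversals []       = Vec.[] ∷ []
transversals (k ∷ ks) = cartesianProductWith Vec._++_ (singleZero k) (transversals ks)

transversals-unique : ∀ xs → Unique (transversals xs)
transversals-unique []       = [] ∷ []
transversals-unique (k ∷ ks) =
  Unique.cartesianProductWith⁺ Vec._++_ (Vec.++-injective _ _)
    (singleZero-unique k) (transversals-unique ks)

length-transversals : ∀ xs → length (transversals xs) ≡ product xs
length-transversals []       = refl
length-transversals (k ∷ ks) =
  trans (length-cartesianProductWith Vec._++_ (singleZero k) (transversals ks))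
        (cong₂ _*_ (length-singleZero k) (length-transversals ks))

transversals-⊨ : ∀ xs {a} → a ∈ transversals xs → a ⊨ blocks xs × length xs + weight a ≡ sum xs
transversals-⊨ []       (here refl) = [] , refl
transversals-⊨ (k ∷ ks) a∈
  with b , c , b∈ , c∈ , refl ← ∈-cartesianProductWith⁻ Vec._++_ (singleZero k) (transversals ks) a∈
  with c⊨ , wc ← transversals-⊨ ks c∈
  = All.++⁺ (⊨-rename⁺ _ (Vec.lookup-++ˡ b c) (All.lookup (singleZero-⊨ k) b∈))
            (⊨-rename⁺ _ (Vec.lookup-++ʳ b c) c⊨) ,
    trans (cong (suc (length ks) +_) (weight-++ b c))
      (trans (solve 3 (λ b l c → con 1 :+ l :+ (b :+ c) := con 1 :+ b :+ (l :+ c))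
               refl (weight b) (length ks) (weight c))
        (cong₂ _+_ (All.lookup (singleZero-weight k) b∈) wc))
  where open +-*-Solver

-- An inequality is enough: for balanced block sizes the upper bound turns it into an equality.
∃-product≤#sat : ∀ {n} t xs → length xs + t ≡ n → sum xs ≡ n →
  ∃ λ (F : CNF n) → F IsCNFOfWidth≤ 2 × Admissible t F × product xs ≤ #sat t F
∃-product≤#sat t xs length+t refl =
  blocks xs , blocks-width xs ,
  -- Both `length xs + t` and `sum xs` equal `n`, so `blocks-weight` says that every solution has
  -- weight at least `t`.
  (λ (a , a⊨ , wa<t) → <⇒≱ wa<t
    (+-cancelˡ-≤ (length xs) _ _ (≤-trans (≤-reflexive length+t) (blocks-weight xs a a⊨)))) ,
  ≤-trans (≤-reflexive (sym (length-transversals xs)))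
    (length-mono-⊆ (transversals-unique xs) λ {a} a∈ →
      let a⊨ , wa = transversals-⊨ xs a∈ in
      ∈-sat⁺ a⊨ (+-cancelˡ-≡ (length xs) _ _ (trans wa (sym length+t))))

-- Blocks of nearly equal size

balanced : ℕ → ℕ → ℕ → List ℕ
balanced q e r = replicate e q ++ replicate r (suc q)

length-balanced : ∀ q e r → length (balanced q e r) ≡ e + r
length-balanced q e r = trans (List.length-++ (replicate e q))
  (cong₂ _+_ (List.length-replicate e) (List.length-replicate r))

sum-balanced : ∀ q e r → sum (balanced q e r) ≡ (e + r) * q + r
sum-balanced q e r = trans (sum-++ (replicate e q) _)
  (trans (cong₂ _+_ (sum-replicate e q) (sum-replicate r (suc q)))
    (solve 3 (λ e r q → e :* q :+ r :* (con 1 :+ q) := (e :+ r) :* q :+ r) refl e r q))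
  where open +-*-Solver

product-replicate : ∀ m k → product (replicate m k) ≡ k ^ m
product-replicate zero    k = refl
product-replicate (suc m) k = cong (k *_) (product-replicate m k)

product-balanced : ∀ q e r → product (balanced q e r) ≡ q ^ e * suc q ^ r
product-balanced q e r = trans (product-++ (replicate e q) _)
  (cong₂ _*_ (product-replicate e q) (product-replicate r (suc q)))

-- Writing `n ∸ t` as `e + r` keeps truncated subtraction out of the exponents.
S-balanced : ∀ {n t} q e r .{{_ : NonZero q}} → t ≤ n → e + r ≡ n ∸ t → n ≡ (e + r) * q + r →
             S[ n , t , 2 ]≡ (q ^ e * suc q ^ r)
S-balanced {n} {t} q e r t≤n e+r≡d n≡ =
  let F , F₂ , adm , product≤#sat = ∃-product≤#sat t (balanced q e r)
        (trans (cong (_+ t) (trans (length-balanced q e r) e+r≡d)) (m∸n+n≡m t≤n))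
        (trans (sum-balanced q e r) (sym n≡))
  in (F , F₂ , adm , ≤-antisym (upper F F₂ adm)
       (≤-trans (≤-reflexive (sym (product-balanced q e r))) product≤#sat)) ,
     λ { _ (F , F₂ , adm , refl) → upper F F₂ adm }
  where
  upper : (F : CNF n) → F IsCNFOfWidth≤ 2 → Admissible t F → #sat t F ≤ q ^ e * suc q ^ r
  upper F F₂ adm with #sat≤product t F F₂ adm t≤n
  ... | xs , length-xs , sum-xs , bound = ≤-trans bound
    (product≤ q e r xs (trans length-xs (sym e+r≡d)) (≤-trans sum-xs (≤-reflexive n≡)))

theorem3 : ∀ (n t q r : ℕ) → 1 ≤ n → t < n →
    n ≡ (n ∸ t) * q + r → r < n ∸ t →
    S[ n , t , 2 ]≡ (q ^ (n ∸ t ∸ r) * (q + 1) ^ r)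
-- A zero quotient would give `n ≡ r`, although `r < n ∸ t ≤ n`.
theorem3 n t zero r _ _ n≡ r<d =
  contradiction (≤-reflexive (trans n≡ (cong (_+ r) (*-zeroʳ (n ∸ t)))))
    (<⇒≱ (≤-trans r<d (m∸n≤m n t)))
theorem3 n t q@(suc _) r _ t<n n≡ r<d =
  subst (λ p → S[ n , t , 2 ]≡ (q ^ (n ∸ t ∸ r) * p ^ r)) (+-comm 1 q)
    (S-balanced q (n ∸ t ∸ r) r (<⇒≤ t<n) e+r≡d
      (trans n≡ (cong (λ d → d * q + r) (sym e+r≡d))))
  where
  e+r≡d : n ∸ t ∸ r + r ≡ n ∸ t
  e+r≡d = m∸n+n≡m (<⇒≤ r<d)
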